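{- Let $\mathcal{R}$ be a right-stable DCTRS such that $\mathbb{U}_{seq}(\mathcal{R})$ is confluent and terminating. Then $\mathbb{U}_{seq}$ is sound for reductions to normal forms: for all $u, v \in \mathcal{T}$ such that $u \rightarrow^*_{\mathbb{U}_{seq}(\mathcal{R})} v$ and $v$ is a normal form w.r.t. $\mathbb{U}_{seq}(\mathcal{R})$, we have $u \rightarrow^*_{\mathcal{R}} v$.
   Context: Terms $\mathcal{T}=\mathcal{T}(\mathcal{F},\mathcal{V})$ over a signature $\mathcal{F}$ and a countably infinite set of variables $\mathcal{V}$. An (oriented) conditional rule has the form $l \rightarrow r \Leftarrow s_1 \rightarrow^* t_1, \ldots, s_k \rightarrow^* t_k$ ($k\ge 0$). It is deterministic if $\mathcal{V}ar(r) \subseteq \mathcal{V}ar(l) \cup \mathcal{V}ar(s_1,t_1,\ldots,s_k,t_k)$ and $\mathcal{V}ar(s_i) \subseteq \mathcal{V}ar(l, t_1, \ldots, t_{i-1})$ for all $i$. A DCTRS $\mathcal{R}$ is a set of such rules; $\mathcal{R}_u=\{l\rightarrow r \mid l \rightarrow r \Leftarrow c \in \mathcal{R}\}$. Rewrite relation: $\mathcal{R}_0=\emptyset$, $\mathcal{R}_{n+1}=\{l\sigma \rightarrow r\sigma \mid l \rightarrow r \Leftarrow s_1 \rightarrow^* t_1,\ldots \in \mathcal{R},\ s_j\sigma \rightarrow^*_{\mathcal{R}_n} t_j\sigma \text{ for all } j\}$, $\rightarrow_{\mathcal{R}}=\bigcup_n \rightarrow_{\mathcal{R}_n}$. $\mathcal{R}$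 is right-stable if for every rule and every $i$, $t_i$ is either a linear constructor term (no root symbol of a left-hand side of $\mathcal{R}$ occurs in it) or a ground term irreducible w.r.t. $\mathcal{R}_u$, and $\mathcal{V}ar(t_i) \cap \mathcal{V}ar(l, s_1, t_1, \ldots, s_{i-1}, t_{i-1}, s_i) = \emptyset$. Sequential unraveling: for $\alpha: l \rightarrow r \Leftarrow s_1 \rightarrow^* t_1, \ldots, s_k \rightarrow^* t_k$ with $k\ge1$, let $X_i=\mathcal{V}ar(l,t_1,\ldots,t_{i-1})$ with fixed ordering $\vec{X_i}$, fresh symbols $U^\alpha_1,\dots,U^\alpha_k$, and $\mathbb{U}_{seq}(\alpha)=\{l \rightarrow U^\alpha_1(s_1,\vec{X_1})\}\cup\{U^\alpha_i(t_i,\vec{X_i}) \rightarrow U^\alpha_{i+1}(s_{i+1},\vec{X_{i+1}}) \mid 1\le i<k\}\cup\{U^\alpha_k(t_k,\vec{X_k}) \rightarrow r\}$; unconditional rules are kept unchanged. $\mathbb{U}_{seq}(\mathcal{R})=\bigcup_{\alpha}\mathbb{U}_{seq}(\alpha)$. -}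

module Defs where

open import Data.Nat using (ℕ; zero; suc; _≟_)
open import Data.Fin using (Fin; toℕ)
open import Data.Empty using (⊥)
open import Data.Unit using (⊤)
open import Data.Maybe using (Maybe; just; nothing)
open import Data.Product using (Σ; ∃; _×_; _,_; proj₁; proj₂)
open import Data.Sum using (_⊎_; inj₁; inj₂)
open import Data.List using (List; []; _∷_; [_]; _++_; length; take; map; lookup; concatMap; deduplicate)
open import Data.List.Membership.Propositional using (_∈_; _∉_)
open import Data.List.Relation.Binary.Subset.Propositional using (_⊆_)
open import Data.List.Relation.Unary.All using (All)
open import Data.List.Relation.Unary.Unique.Propositional using (Unique)
open import Data.Vec using (Vec; []; _∷_; _[_]≔_; fromList) renaming (lookup to vlookup; map to vmap)
open import Relation.Nullary using (¬_)
open import Relation.Binary.PropositionalEquality using (_≡_; _≢_)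
open import Relation.Binary.Construct.Closure.ReflexiveTransitive using (Star)
open import Induction.WellFounded using (WellFounded)

record Signature : Set₁ where
  field
    Sym   : Set
    arity : Sym → ℕ
open Signature public

data Term (Sg : Signature) : Set where
  var : ℕ → Term Sg
  fun : (f : Sym Sg) → Vec (Term Sg) (arity Sg f) → Term Sg

Subst : Signature → Set
Subst Sg = ℕ → Term Sg

module _ {Sg : Signature} where

  mutual
    _⟨_⟩ : Term Sg → Subst Sg → Term Sg
    var x    ⟨ σ ⟩ = σ x
    fun f ts ⟨ σ ⟩ = fun f (substs ts σ)

    substs : ∀ {n} → Vec (Term Sg) n → Subst Sg → Vec (Term Sg) n
    substs []       σ = []
    substs (t ∷ ts) σ = (t ⟨ σ ⟩) ∷ substs ts σ

  mutual
    varsM : Term Sg → List ℕ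
    varsM (var x)    = [ x ]
    varsM (fun f ts) = varsMs ts

    varsMs : ∀ {n} → Vec (Term Sg) n → List ℕ
    varsMs []       = []
    varsMs (t ∷ ts) = varsM t ++ varsMs ts

  mutual
    syms : Term Sg → List (Sym Sg)
    syms (var x)    = []
    syms (fun f ts) = f ∷ symss ts

    symss : ∀ {n} → Vec (Term Sg) n → List (Sym Sg)
    symss []       = []
    symss (t ∷ ts) = syms t ++ symss ts

  root : Term Sg → Maybe (Sym Sg)
  root (var x)   = nothing
  root (fun f _) = just f

  Linear : Term Sg → Set
  Linear t = Unique (varsM t)

  Ground : Term Sg → Set
  Ground t = varsM t ≡ []

  data Ctx (Top : Term Sg → Term Sg → Set) : Term Sg → Term Sg → Set where
    root-step : ∀ {s t} → Top s t → Ctx Top s t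
    arg-step  : ∀ {t} (f : Sym Sg) (ts : Vec (Term Sg) (arity Sg f)) (i : Fin (arity Sg f)) →
                Ctx Top (vlookup ts i) t → Ctx Top (fun f ts) (fun f (ts [ i ]≔ t))

  TRSStep : (Term Sg → Term Sg → Set) → Term Sg → Term Sg → Set
  TRSStep Rules = Ctx (λ s t → Σ (Term Sg) λ l → Σ (Term Sg) λ r → Σ (Subst Sg) λ σ →
                        Rules l r × s ≡ l ⟨ σ ⟩ × t ≡ r ⟨ σ ⟩)

  NormalForm : (Term Sg → Term Sg → Set) → Term Sg → Set
  NormalForm step v = ¬ (Σ (Term Sg) λ w → step v w)

  Confluent : (Term Sg → Term Sg → Set) → Set
  Confluent step = ∀ s t₁ t₂ → Star step s t₁ → Star step s t₂ →
                   Σ (Term Sg) λ u → Star step t₁ u × Star step t₂ u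

  Terminating : (Term Sg → Term Sg → Set) → Set
  Terminating step = WellFounded (λ t s → step s t)

-- Conditional rules  l → r ⇐ s₁ →* t₁, …, s_k →* t_k

record CRule (Sg : Signature) : Set where
  constructor _⇒_⇐_
  field
    lhs   : Term Sg
    rhs   : Term Sg
    conds : List (Term Sg × Term Sg)
open CRule public

module _ {Sg : Signature} where

  condVars : List (Term Sg × Term Sg) → List ℕ
  condVars = concatMap (λ c → varsM (proj₁ c) ++ varsM (proj₂ c))

  DetConds : List ℕ → List (Term Sg × Term Sg) → Set
  DetConds X []             = ⊤
  DetConds X ((s , t) ∷ cs) = (varsM s ⊆ X) × DetConds (X ++ varsM t) cs

  Deterministic : CRule Sg → Set
  Deterministic α =
    (varsM (rhs α) ⊆ varsM (lhs α) ++ condVars (conds α)) × DetConds (varsM (lhs α)) (conds α)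

-- A (D)CTRS is a family of rules ρ indexed by an arbitrary type I

module _ {Sg : Signature} (I : Set) (ρ : I → CRule Sg) where

  RuRules : Term Sg → Term Sg → Set
  RuRules l r = Σ I λ i → lhs (ρ i) ≡ l × rhs (ρ i) ≡ r

  RuStep : Term Sg → Term Sg → Set
  RuStep = TRSStep RuRules

  ConstructorTerm : Term Sg → Set
  ConstructorTerm t = ∀ f → f ∈ syms t → ∀ i → root (lhs (ρ i)) ≢ just f

  -- right-stability conditions for the remaining conditions, given the
  -- variables Y = Var(l, s₁, t₁, …, s_{i-1}, t_{i-1}) seen so far
  RSConds : List ℕ → List (Term Sg × Term Sg) → Set
  RSConds Y []             = ⊤
  RSConds Y ((s , t) ∷ cs) =
    ((ConstructorTerm t × Linear t) ⊎ (Ground t × NormalForm RuStep t))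
    × (∀ x → x ∈ varsM t → x ∉ Y ++ varsM s)
    × RSConds (Y ++ varsM s ++ varsM t) cs

  RightStable : Set
  RightStable = ∀ i → RSConds (varsM (lhs (ρ i))) (conds (ρ i))

  mutual
    CStepN : ℕ → Term Sg → Term Sg → Set
    CStepN zero    s t = ⊥
    CStepN (suc n) s t = Ctx (CTop n) s t

    CTop : ℕ → Term Sg → Term Sg → Set
    CTop n s t = Σ I λ i → Σ (Subst Sg) λ σ →
                 s ≡ lhs (ρ i) ⟨ σ ⟩ × t ≡ rhs (ρ i) ⟨ σ ⟩ ×
                 All (λ c → Star (CStepN n) (proj₁ c ⟨ σ ⟩) (proj₂ c ⟨ σ ⟩)) (conds (ρ i))

  CStep : Term Sg → Term Sg → Set
  CStep s t = Σ ℕ λ n → CStepN n s t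

  -- X_{j+1} = Var(l, t₁, …, t_j) for j : Fin k (0-based index of U^α_{j+1}),
  -- listed without repetitions in a fixed (first-occurrence) order
  Xs : (i : I) → Fin (length (conds (ρ i))) → List ℕ
  Xs i j = deduplicate _≟_
             (varsM (lhs (ρ i)) ++ concatMap (λ c → varsM (proj₂ c)) (take (toℕ j) (conds (ρ i))))

  USig : Signature
  USig = record
    { Sym   = Sym Sg ⊎ (Σ I λ i → Fin (length (conds (ρ i))))
    ; arity = λ { (inj₁ f) → arity Sg f
                ; (inj₂ (i , j)) → suc (length (Xs i j)) } }

  mutual
    emb : Term Sg → Term USig
    emb (var x)    = var x
    emb (fun f ts) = fun (inj₁ f) (embs ts)

    embs : ∀ {n} → Vec (Term Sg) n → Vec (Term USig) n
    embs []       = []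
    embs (t ∷ ts) = emb t ∷ embs ts

  U : (i : I) (j : Fin (length (conds (ρ i)))) → Term USig → Term USig
  U i j u = fun (inj₂ (i , j)) (u ∷ vmap var (fromList (Xs i j)))

  cs : (i : I) → Fin (length (conds (ρ i))) → Term Sg
  cs i j = proj₁ (lookup (conds (ρ i)) j)

  ct : (i : I) → Fin (length (conds (ρ i))) → Term Sg
  ct i j = proj₂ (lookup (conds (ρ i)) j)

  data UseqRule : Term USig → Term USig → Set where
    uncond : (i : I) → conds (ρ i) ≡ [] → UseqRule (emb (lhs (ρ i))) (emb (rhs (ρ i)))
    first  : (i : I) (j : Fin (length (conds (ρ i)))) → toℕ j ≡ 0 →
             UseqRule (emb (lhs (ρ i))) (U i j (emb (cs i j)))
    middle : (i : I) (j j' : Fin (length (conds (ρ i)))) → toℕ j' ≡ suc (toℕ j) →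
             UseqRule (U i j (emb (ct i j))) (U i j' (emb (cs i j')))
    last   : (i : I) (j : Fin (length (conds (ρ i)))) → suc (toℕ j) ≡ length (conds (ρ i)) →
             UseqRule (U i j (emb (ct i j))) (emb (rhs (ρ i)))

  UseqStep : Term USig → Term USig → Set
  UseqStep = TRSStep UseqRule

{-# OPTIONS --safe #-}

-- Classically the idea is innermost rewriting.  If the arguments of l σ are
-- normal, then the instances of X_i never change while U_1(s_1, X_1)σ is being
-- evaluated, so each s_i σ →* t_i σ is a reduction for one fixed σ and the
-- evaluation can be read back as a single conditional step.  Reading a stuck
-- U_i(w, X_i σ) back as l σ is a function on terms, so non-linear rules do no
-- harm.  By confluence the innermost normal form of u is v.
--
-- Innermost rewriting needs to decide whether a term is a redex, which is not
-- possible constructively.  The argument is therefore run in the continuation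
-- monad whose answer type G is the desired conclusion u →* v, with ⊥ replaced
-- by G in the definition of normal forms.
module Submission where

open import Defs
open import Data.Empty using (⊥; ⊥-elim)
open import Data.Fin using (Fin; zero; suc; toℕ)
open import Data.Fin.Properties using (toℕ-injective; toℕ<n)
open import Data.List using (List; []; _∷_; _++_; length; take; concatMap; lookup)
open import Data.List.Membership.Propositional using (_∈_)
open import Data.List.Membership.Propositional.Properties using (∈-++⁺ˡ; ∈-++⁺ʳ; ∈-++⁻; ∈-deduplicate⁺; ∈-deduplicate⁻)
open import Data.List.Properties using (++-assoc)
open import Data.List.Relation.Binary.Subset.Propositional using (_⊆_)
open import Data.List.Relation.Unary.All using (All; []; _∷_)
open import Data.List.Relation.Unary.Any using (here; there)
open import Data.Nat using (ℕ; zero; suc; _≤_; _<_; s≤s; _≟_; _⊔_)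
open import Data.Nat.Properties using (≤-reflexive; <⇒≤; m<1+n⇒m<n∨m≡n; m≤m⊔n; m≤n⊔m)
open import Data.Product using (Σ; _×_; _,_; proj₁; proj₂)
open import Data.Sum using (_⊎_; inj₁; inj₂)
open import Data.Vec using (Vec; []; _∷_; _[_]≔_; fromList) renaming (lookup to vlookup; map to vmap)
open import Data.Vec.Properties using (∷-injective; lookup∘update)
open import Data.Vec.Relation.Binary.Pointwise.Inductive using (Pointwise; []; _∷_)
open import Function using (_∘_)
open import Induction.WellFounded using (Acc; acc; WellFounded)
open import Relation.Binary.Construct.Closure.ReflexiveTransitive as Star using (Star; ε; _◅_; _◅◅_)
open import Relation.Binary.Construct.Closure.Transitive as Plus using (TransClosure; [_])
open import Relation.Binary.PropositionalEquality using (_≡_; _≢_; refl; sym; trans; cong; cong₂; subst; subst₂)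
open import Relation.Nullary using (yes; no; contradiction)

-- Variables collected over prefixes of a list.

module _ {A B : Set} (f : A → List B) where

  concatMap-take-mono : ∀ {m n x} (xs : List A) → m ≤ n →
    x ∈ concatMap f (take m xs) → x ∈ concatMap f (take n xs)
  concatMap-take-mono []       (s≤s _)   ()
  concatMap-take-mono (a ∷ xs) (s≤s m≤n) p with ∈-++⁻ (f a) p
  ... | inj₁ q = ∈-++⁺ˡ q
  ... | inj₂ q = ∈-++⁺ʳ (f a) (concatMap-take-mono xs m≤n q)

  lookup⊆concatMap-take : ∀ {n x} (xs : List A) (k : Fin (length xs)) → toℕ k < n →
    x ∈ f (lookup xs k) → x ∈ concatMap f (take n xs)
  lookup⊆concatMap-take (a ∷ xs) zero    (s≤s _)   p = ∈-++⁺ˡ p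
  lookup⊆concatMap-take (a ∷ xs) (suc k) (s≤s k<n) p =
    ∈-++⁺ʳ (f a) (lookup⊆concatMap-take xs k k<n p)

  concatMap-take-suc⁻ : ∀ {x} (xs : List A) (k : Fin (length xs)) →
    x ∈ concatMap f (take (suc (toℕ k)) xs) →
    x ∈ concatMap f (take (toℕ k) xs) ⊎ x ∈ f (lookup xs k)
  concatMap-take-suc⁻ (a ∷ xs) zero p with ∈-++⁻ (f a) p
  ... | inj₁ q = inj₂ q
  ... | inj₂ ()
  concatMap-take-suc⁻ (a ∷ xs) (suc k) p with ∈-++⁻ (f a) p
  ... | inj₁ q = inj₁ (∈-++⁺ˡ q)
  ... | inj₂ q with concatMap-take-suc⁻ xs k q
  ...   | inj₁ r = inj₁ (∈-++⁺ʳ (f a) r)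
  ...   | inj₂ r = inj₂ r

  concatMap-lookup⁻ : ∀ {x} (xs : List A) → x ∈ concatMap f xs →
    Σ (Fin (length xs)) λ k → x ∈ f (lookup xs k)
  concatMap-lookup⁻ (a ∷ xs) p with ∈-++⁻ (f a) p
  ... | inj₁ q = zero , q
  ... | inj₂ q with concatMap-lookup⁻ xs q
  ...   | k , r = suc k , r

All-lookup⁺ : {A : Set} {P : A → Set} (xs : List A) → (∀ k → P (lookup xs k)) → All P xs
All-lookup⁺ []       h = []
All-lookup⁺ (x ∷ xs) h = h zero ∷ All-lookup⁺ xs (h ∘ suc)

-- Terms: substitutions, subterms and the induction order.

module _ {Sg : Signature} where

  DetConds⇒⊆ : (X : List ℕ) (cs : List (Term Sg × Term Sg)) → DetConds X cs →
    ∀ k → varsM (proj₁ (lookup cs k)) ⊆ X ++ concatMap (varsM ∘ proj₂) (take (toℕ k) cs)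
  DetConds⇒⊆ X (_ ∷ cs)       (p , _) zero    q = ∈-++⁺ˡ (p q)
  DetConds⇒⊆ X ((_ , t) ∷ cs) (_ , d) (suc k) q =
    subst (_ ∈_) (++-assoc X (varsM t) _) (DetConds⇒⊆ (X ++ varsM t) cs d k q)

  mutual
    ⟨⟩-cong : (e : Term Sg) {σ τ : Subst Sg} → (∀ {x} → x ∈ varsM e → σ x ≡ τ x) → e ⟨ σ ⟩ ≡ e ⟨ τ ⟩
    ⟨⟩-cong (var x)    h = h (here refl)
    ⟨⟩-cong (fun f ts) h = cong (fun f) (substs-cong ts h)

    substs-cong : ∀ {n} (ts : Vec (Term Sg) n) {σ τ : Subst Sg} →
      (∀ {x} → x ∈ varsMs ts → σ x ≡ τ x) → substs ts σ ≡ substs ts τ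
    substs-cong []       h = refl
    substs-cong (t ∷ ts) h =
      cong₂ _∷_ (⟨⟩-cong t (h ∘ ∈-++⁺ˡ)) (substs-cong ts (h ∘ ∈-++⁺ʳ (varsM t)))

  mutual
    ⟨var⟩ : (e : Term Sg) → e ⟨ var ⟩ ≡ e
    ⟨var⟩ (var x)    = refl
    ⟨var⟩ (fun f ts) = cong (fun f) (substs-var ts)

    substs-var : ∀ {n} (ts : Vec (Term Sg) n) → substs ts var ≡ ts
    substs-var []       = refl
    substs-var (t ∷ ts) = cong₂ _∷_ (⟨var⟩ t) (substs-var ts)

  -- `C` is an arbitrary context, so that the induction can absorb the arguments already rewritten
  -- into it.
  Star-args : (R : Term Sg → Term Sg → Set) {n : ℕ} (C : Vec (Term Sg) n → Term Sg) →
    (∀ ts k {t} → R (vlookup ts k) t → R (C ts) (C (ts [ k ]≔ t))) →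
    ∀ {ts us} → Pointwise (Star R) ts us → Star R (C ts) (C us)
  Star-args R C cong-C []                       = ε
  Star-args R C cong-C {t ∷ ts} {u ∷ us} (p ∷ ps) =
    head p ◅◅ Star-args R (C ∘ (u ∷_)) (λ vs k → cong-C (u ∷ vs) (suc k)) ps
    where
    head : ∀ {a b} → Star R a b → Star R (C (a ∷ ts)) (C (b ∷ ts))
    head = Star.gmap (λ a → C (a ∷ ts)) (λ {a} → cong-C (a ∷ ts) zero)

  data _⊴_ (t : Term Sg) : Term Sg → Set where
    ⊴-refl : t ⊴ t
    ⊴-arg  : ∀ {f us} k → t ⊴ vlookup us k → t ⊴ fun f us

  ⊴-step : {Top : Term Sg → Term Sg → Set} {s t t' : Term Sg} → t ⊴ s → Ctx Top t t' →
    Σ (Term Sg) λ s' → Ctx Top s s' × t' ⊴ s'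
  ⊴-step ⊴-refl        st = _ , st , ⊴-refl
  ⊴-step {t' = t'} (⊴-arg {f} {us} k sub) st with ⊴-step sub st
  ... | s' , st' , sub' =
    _ , arg-step f us k st' , ⊴-arg k (subst (t' ⊴_) (sym (lookup∘update k us s')) sub')

  data StepOrArg (Top : Term Sg → Term Sg → Set) : Term Sg → Term Sg → Set where
    by-step : ∀ {s t} → Ctx Top s t → StepOrArg Top t s
    by-arg  : ∀ {f us} k → StepOrArg Top (vlookup us k) (fun f us)

  -- Outer induction on the reductions of `s`, inner structural induction on its subterm `t`. A step
  -- of `t` is also a step of `s`, and its result is a subterm of the new `s`, so the outer
  -- induction takes over.
  StepOrArg-wellFounded : (Top : Term Sg → Term Sg → Set) →
    Terminating (Ctx Top) → WellFounded (StepOrArg Top)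
  StepOrArg-wellFounded Top wf s = go s (wf s) s ⊴-refl
    where
    go : ∀ s → Acc (λ t s → Ctx Top s t) s → ∀ t → t ⊴ s → Acc (StepOrArg Top) t
    args : ∀ s → Acc (λ t s → Ctx Top s t) s → ∀ {n} (us : Vec (Term Sg) n) →
      (∀ k → vlookup us k ⊴ s) → ∀ k → Acc (StepOrArg Top) (vlookup us k)
    stepped : ∀ s → Acc (λ t s → Ctx Top s t) s → ∀ {t t'} → t ⊴ s → Ctx Top t t' → Acc (StepOrArg Top) t'
    stepped s (acc rs) sub st with ⊴-step sub st
    ... | s' , st' , sub' = go s' (rs st') _ sub'
    go s a (var x) sub = acc λ { (by-step st) → stepped s a sub st }
    go s a (fun f us) sub = acc λ { (by-step st) → stepped s a sub st
                                  ; (by-arg k) → args s a us (λ k → ⊴-arg-of sub k) k }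
      where
      ⊴-arg-of : ∀ {s} → fun f us ⊴ s → ∀ k → vlookup us k ⊴ s
      ⊴-arg-of ⊴-refl         k = ⊴-arg k ⊴-refl
      ⊴-arg-of (⊴-arg k' sub) k = ⊴-arg k' (⊴-arg-of sub k)
    args s a (u ∷ us) subs zero    = go s a u (subs zero)
    args s a (u ∷ us) subs (suc k) = args s a us (subs ∘ suc) k

  -- Lets a term below a reduct of `s` count as below `s` itself, for which the induction hypothesis
  -- is available.
  Star-TransClosure : {Top : Term Sg → Term Sg → Set} {s s' t : Term Sg} → Star (Ctx Top) s s' →
    TransClosure (StepOrArg Top) t s' → TransClosure (StepOrArg Top) t s
  Star-TransClosure ε          p = p
  Star-TransClosure (st ◅ sts) p = Star-TransClosure sts p Plus.∷ʳ by-step st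

  -- The default var y is junk: only variables in xs are ever looked up.
  assign : (xs : List ℕ) → Vec (Term Sg) (length xs) → Subst Sg
  assign []       []       y = var y
  assign (x ∷ xs) (t ∷ ts) y with y ≟ x
  ... | yes _ = t
  ... | no  _ = assign xs ts y

  fun-injectiveˡ : ∀ {f g} {ts : Vec (Term Sg) (arity Sg f)} {us : Vec (Term Sg) (arity Sg g)} →
    fun f ts ≡ fun g us → f ≡ g
  fun-injectiveˡ refl = refl

  fun-injectiveʳ : ∀ {f} {ts us : Vec (Term Sg) (arity Sg f)} → fun f ts ≡ fun f us → ts ≡ us
  fun-injectiveʳ refl = refl

  -- Matching a `U`-term only equates argument vectors; this recovers that the old substitution and
  -- the matcher agree on the stored variables.
  substs-vars-injective : ∀ {σ τ : Subst Sg} (xs : List ℕ) →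
    substs (vmap var (fromList xs)) σ ≡ substs (vmap var (fromList xs)) τ →
    ∀ {x} → x ∈ xs → σ x ≡ τ x
  substs-vars-injective (x ∷ xs) eq (here refl) = proj₁ (∷-injective eq)
  substs-vars-injective (x ∷ xs) eq (there p)   = substs-vars-injective xs (proj₂ (∷-injective eq)) p

  lookup-substs-vars : ∀ (P : Term Sg → Set) {σ : Subst Sg} (xs : List ℕ) →
    (∀ {x} → x ∈ xs → P (σ x)) → ∀ k → P (vlookup (substs (vmap var (fromList xs)) σ) k)
  lookup-substs-vars P (x ∷ xs) h zero    = h (here refl)
  lookup-substs-vars P (x ∷ xs) h (suc k) = lookup-substs-vars P xs (h ∘ there) k

-- Levels of conditional rewriting.

module _ {Sg : Signature} (I : Set) (ρ : I → CRule Sg) where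

  mutual
    CStepN-mono : ∀ {m n s t} → m ≤ n → CStepN I ρ m s t → CStepN I ρ n s t
    CStepN-mono (s≤s m≤n) st = Ctx-mono m≤n st

    Ctx-mono : ∀ {m n s t} → m ≤ n → Ctx (CTop I ρ m) s t → Ctx (CTop I ρ n) s t
    Ctx-mono m≤n (root-step (i , σ , p , q , h)) = root-step (i , σ , p , q , All-mono m≤n h)
    Ctx-mono m≤n (arg-step f ts k st)            = arg-step f ts k (Ctx-mono m≤n st)

    All-mono : ∀ {m n} {cs : List (Term Sg × Term Sg)} {σ : Subst Sg} → m ≤ n →
      All (λ c → Star (CStepN I ρ m) (proj₁ c ⟨ σ ⟩) (proj₂ c ⟨ σ ⟩)) cs →
      All (λ c → Star (CStepN I ρ n) (proj₁ c ⟨ σ ⟩) (proj₂ c ⟨ σ ⟩)) cs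
    All-mono m≤n []       = []
    All-mono m≤n (h ∷ hs) = Star-mono m≤n h ∷ All-mono m≤n hs

    Star-mono : ∀ {m n s t} → m ≤ n → Star (CStepN I ρ m) s t → Star (CStepN I ρ n) s t
    Star-mono m≤n ε          = ε
    Star-mono m≤n (st ◅ sts) = CStepN-mono m≤n st ◅ Star-mono m≤n sts

  Star-CStep⁻ : ∀ {s t} → Star (CStep I ρ) s t → Σ ℕ λ n → Star (CStepN I ρ n) s t
  Star-CStep⁻ ε = 0 , ε
  Star-CStep⁻ ((m , st) ◅ sts) with Star-CStep⁻ sts
  ... | n , sts' = m ⊔ n , CStepN-mono (m≤m⊔n m n) st ◅ Star-mono (m≤n⊔m m n) sts'

  -- A rule application needs one level for all its conditions; the maximum serves, since levels are
  -- cumulative.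
  conds-level : ∀ {σ} (cs : List (Term Sg × Term Sg)) →
    All (λ c → Star (CStep I ρ) (proj₁ c ⟨ σ ⟩) (proj₂ c ⟨ σ ⟩)) cs →
    Σ ℕ λ n → All (λ c → Star (CStepN I ρ n) (proj₁ c ⟨ σ ⟩) (proj₂ c ⟨ σ ⟩)) cs
  conds-level []       []       = 0 , []
  conds-level (c ∷ cs) (h ∷ hs) with Star-CStep⁻ h | conds-level cs hs
  ... | m , h' | n , hs' = m ⊔ n , Star-mono (m≤m⊔n m n) h' ∷ All-mono (m≤n⊔m m n) hs'

  rule-CStep : ∀ i σ → All (λ c → Star (CStep I ρ) (proj₁ c ⟨ σ ⟩) (proj₂ c ⟨ σ ⟩)) (conds (ρ i)) →
    CStep I ρ (lhs (ρ i) ⟨ σ ⟩) (rhs (ρ i) ⟨ σ ⟩)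
  rule-CStep i σ hs with conds-level (conds (ρ i)) hs
  ... | n , hs' = suc n , root-step (i , σ , refl , refl , hs')

  CStep-args : ∀ f {ts us : Vec (Term Sg) (arity Sg f)} →
    Pointwise (Star (CStep I ρ)) ts us → Star (CStep I ρ) (fun f ts) (fun f us)
  CStep-args f = Star-args (CStep I ρ) (fun f)
    λ { ts k (suc n , st) → suc n , arg-step f ts k st }

  -- The variable sequences stored by the `U`-symbols.

  private
    Cond : I → Set
    Cond i = Fin (length (conds (ρ i)))

    UTerm : Set
    UTerm = Term (USig I ρ)

  lhs⊆Xs : ∀ i j → varsM (lhs (ρ i)) ⊆ Xs I ρ i j
  lhs⊆Xs i j p = ∈-deduplicate⁺ _≟_ (∈-++⁺ˡ p)

  -- The inequality is strict: with 0-based indices, `Xs i j` collects the right sides of the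
  -- conditions before `j`, not that of `j` itself.
  ct⊆Xs : ∀ i (k j : Cond i) → toℕ k < toℕ j → varsM (ct I ρ i k) ⊆ Xs I ρ i j
  ct⊆Xs i k j k<j p =
    ∈-deduplicate⁺ _≟_ (∈-++⁺ʳ (varsM (lhs (ρ i))) (lookup⊆concatMap-take _ (conds (ρ i)) k k<j p))

  Xs-mono : ∀ i (k j : Cond i) → toℕ k ≤ toℕ j → Xs I ρ i k ⊆ Xs I ρ i j
  Xs-mono i k j k≤j p with ∈-++⁻ (varsM (lhs (ρ i))) (∈-deduplicate⁻ _≟_ _ p)
  ... | inj₁ q = lhs⊆Xs i j q
  ... | inj₂ q = ∈-deduplicate⁺ _≟_ (∈-++⁺ʳ (varsM (lhs (ρ i))) (concatMap-take-mono _ (conds (ρ i)) k≤j q))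

  Xs-zero : ∀ i (j : Cond i) → toℕ j ≡ 0 → Xs I ρ i j ⊆ varsM (lhs (ρ i))
  Xs-zero i j j≡0 p with ∈-++⁻ (varsM (lhs (ρ i))) (∈-deduplicate⁻ _≟_ _ p)
  ... | inj₁ q = q
  ... | inj₂ q rewrite j≡0 with q
  ...   | ()

  Xs-suc : ∀ i (j j' : Cond i) → toℕ j' ≡ suc (toℕ j) →
    ∀ {x} → x ∈ Xs I ρ i j' → x ∈ Xs I ρ i j ⊎ x ∈ varsM (ct I ρ i j)
  Xs-suc i j j' eq p with ∈-++⁻ (varsM (lhs (ρ i))) (∈-deduplicate⁻ _≟_ _ p)
  ... | inj₁ q = inj₁ (lhs⊆Xs i j q)
  ... | inj₂ q rewrite eq with concatMap-take-suc⁻ _ (conds (ρ i)) j q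
  ...   | inj₁ r = inj₁ (∈-deduplicate⁺ _≟_ (∈-++⁺ʳ (varsM (lhs (ρ i))) r))
  ...   | inj₂ r = inj₂ r

  module _ (det : ∀ i → Deterministic (ρ i)) where

    cs⊆Xs : ∀ i j → varsM (cs I ρ i j) ⊆ Xs I ρ i j
    cs⊆Xs i j p =
      ∈-deduplicate⁺ _≟_ (DetConds⇒⊆ (varsM (lhs (ρ i))) (conds (ρ i)) (proj₂ (det i)) j p)

    rhs⊆lhs : ∀ i → conds (ρ i) ≡ [] → varsM (rhs (ρ i)) ⊆ varsM (lhs (ρ i))
    rhs⊆lhs i eq p with ∈-++⁻ (varsM (lhs (ρ i))) (proj₁ (det i) p)
    ... | inj₁ q = q
    ... | inj₂ q rewrite eq with q
    ...   | ()

    -- Variables of any `s_k` lie in `Xs i k`, hence in `Xs i j`, and so do those of `t_k` for `k`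
    -- before the last index `j`. Only `t_j` can contribute new ones.
    rhs⊆last : ∀ i (j : Cond i) → suc (toℕ j) ≡ length (conds (ρ i)) →
      ∀ {x} → x ∈ varsM (rhs (ρ i)) → x ∈ Xs I ρ i j ⊎ x ∈ varsM (ct I ρ i j)
    rhs⊆last i j eq p with ∈-++⁻ (varsM (lhs (ρ i))) (proj₁ (det i) p)
    ... | inj₁ q = inj₁ (lhs⊆Xs i j q)
    ... | inj₂ q with concatMap-lookup⁻ _ (conds (ρ i)) q
    ...   | k , r with ∈-++⁻ (varsM (cs I ρ i k)) r
                     | m<1+n⇒m<n∨m≡n (subst (toℕ k <_) (sym eq) (toℕ<n k))
    ...     | inj₁ a | inj₁ k<j = inj₁ (Xs-mono i k j (<⇒≤ k<j) (cs⊆Xs i k a))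
    ...     | inj₁ a | inj₂ k≡j = inj₁ (Xs-mono i k j (≤-reflexive k≡j) (cs⊆Xs i k a))
    ...     | inj₂ a | inj₁ k<j = inj₁ (ct⊆Xs i k j k<j a)
    ...     | inj₂ a | inj₂ k≡j = inj₂ (subst (λ z → _ ∈ varsM (ct I ρ i z)) (toℕ-injective k≡j) a)

  -- Reading unraveled terms back.

  -- A U-term is read back as the instance of the left-hand side it came from.
  mutual
    back : UTerm → Term Sg
    back (var x)                       = var x
    back (fun (inj₁ f) us)             = fun f (backs us)
    back (fun (inj₂ (i , j)) (_ ∷ us)) = lhs (ρ i) ⟨ assign (Xs I ρ i j) (backs us) ⟩

    backs : ∀ {n} → Vec UTerm n → Vec (Term Sg) n
    backs []       = []
    backs (u ∷ us) = back u ∷ backs us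

  mutual
    back-emb : ∀ e {σ} → back (emb I ρ e ⟨ σ ⟩) ≡ e ⟨ back ∘ σ ⟩
    back-emb (var x)    = refl
    back-emb (fun f ts) = cong (fun f) (backs-embs ts)

    backs-embs : ∀ {n} (ts : Vec (Term Sg) n) {σ} → backs (substs (embs I ρ ts) σ) ≡ substs ts (back ∘ σ)
    backs-embs []       = refl
    backs-embs (t ∷ ts) = cong₂ _∷_ (back-emb t) (backs-embs ts)

  back-emb₀ : ∀ e → back (emb I ρ e) ≡ e
  back-emb₀ e = trans (cong back (sym (⟨var⟩ (emb I ρ e)))) (trans (back-emb e) (⟨var⟩ e))

  assign-backs : ∀ (xs : List ℕ) {σ x} → x ∈ xs →
    assign xs (backs (substs (vmap var (fromList xs)) σ)) x ≡ back (σ x)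
  assign-backs (y ∷ xs) {σ} {x} p with x ≟ y | p
  ... | yes refl | _         = refl
  ... | no x≢y   | here x≡y  = contradiction x≡y x≢y
  ... | no _     | there q   = assign-backs xs q

  -- The stored variables include those of the left-hand side at every stage, so the result depends
  -- neither on `j` nor on the progress of the condition.
  back-U : ∀ i j t {σ} → back (U I ρ i j t ⟨ σ ⟩) ≡ lhs (ρ i) ⟨ back ∘ σ ⟩
  back-U i j t = ⟨⟩-cong (lhs (ρ i)) (assign-backs (Xs I ρ i j) ∘ lhs⊆Xs i j)

  mutual
    var⊴ : ∀ e {σ x} → x ∈ varsM e → σ x ⊴ (emb I ρ e ⟨ σ ⟩)
    var⊴ (var y)    (here refl) = ⊴-refl
    var⊴ (fun f ts) p with vars⊴ ts p
    ... | k , sub = ⊴-arg k sub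

    -- Places `σ x` inside a single argument, so that normality of the arguments of a redex suffices
    -- to make `σ x` normal.
    vars⊴ : ∀ {n} (ts : Vec (Term Sg) n) {σ x} → x ∈ varsMs ts →
      Σ (Fin n) λ k → σ x ⊴ vlookup (substs (embs I ρ ts) σ) k
    vars⊴ (t ∷ ts) p with ∈-++⁻ (varsM t) p
    ... | inj₁ q = zero , var⊴ t q
    ... | inj₂ q with vars⊴ ts q
    ...   | k , sub = suc k , sub

  -- Left-hand sides of a terminating unraveling.

  module _ (wf : Terminating (UseqStep I ρ)) where

    private
      no-total-step : (∀ s → Σ UTerm λ t → UseqStep I ρ s t) → ⊥
      no-total-step h = go (wf (var 0))
        where
        go : ∀ {s} → Acc (λ t s → UseqStep I ρ s t) s → ⊥
        go {s} (acc rs) = go (rs (proj₂ (h s)))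

    -- A variable left-hand side would match every term.
    lhs≢var : ∀ i {x} → lhs (ρ i) ≢ var x
    lhs≢var i eq = no-total-step λ s → _ , root-step
      (_ , _ , (λ _ → s) , proj₂ (starts (conds (ρ i)) refl) ,
       cong (λ e → emb I ρ e ⟨ (λ _ → s) ⟩) (sym eq) , refl)
      where
      toℕ-subst-zero : ∀ {a c d} (p : a ∷ c ≡ d) → toℕ (subst (Fin ∘ length) p zero) ≡ 0
      toℕ-subst-zero refl = refl
      starts : ∀ c → conds (ρ i) ≡ c → Σ UTerm λ r → UseqRule I ρ (emb I ρ (lhs (ρ i))) r
      starts []      e = _ , uncond i e
      -- Index 0 is visible only in `_ ∷ c`; it is transported back along `e`, which keeps its
      -- value.
      starts (_ ∷ c) e = _ , first i (subst (Fin ∘ length) (sym e) zero) (toℕ-subst-zero (sym e))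

    lhs-instance≢var : ∀ i {σ x} → var x ≢ emb I ρ (lhs (ρ i)) ⟨ σ ⟩
    lhs-instance≢var i eq with lhs (ρ i) in e
    ... | var y = lhs≢var i e
    lhs-instance≢var i () | fun _ _

    -- An embedded non-variable term has an original symbol at its root. Thus a `U`-term is
    -- rewritten at its root only by `middle` and `last` rules.
    lhs-instance≢U : ∀ i {σ ij us} → fun (inj₂ ij) us ≢ emb I ρ (lhs (ρ i)) ⟨ σ ⟩
    lhs-instance≢U i eq with lhs (ρ i) in e
    ... | var y = lhs≢var i e
    lhs-instance≢U i () | fun _ _

    -- Innermost evaluation in the continuation monad.

    module Normalisation (det : ∀ i → Deterministic (ρ i)) (G : Set) where

      private
        _→*_ : UTerm → UTerm → Set
        _→*_ = Star (UseqStep I ρ)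

        _↠_ : Term Sg → Term Sg → Set
        _↠_ = Star (CStep I ρ)

        RootStep : UTerm → UTerm → Set
        RootStep s t = Σ UTerm λ l → Σ UTerm λ r → Σ (Subst (USig I ρ)) λ σ →
          UseqRule I ρ l r × s ≡ l ⟨ σ ⟩ × t ≡ r ⟨ σ ⟩

        _≺_ : UTerm → UTerm → Set
        _≺_ = TransClosure (StepOrArg RootStep)

      K : Set → Set
      K P = (P → G) → G

      NF : UTerm → Set
      NF s = ∀ {t} → UseqStep I ρ s t → G

      NF-⊴ : ∀ {s t} → t ⊴ s → NF s → NF t
      NF-⊴ sub n st = n (proj₁ (proj₂ (⊴-step sub st)))

      NF-fun : ∀ {f us} → (∀ k → NF (vlookup us k)) → (Σ UTerm (RootStep (fun f us)) → G) → NF (fun f us)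
      NF-fun ns nr (root-step st)    = nr (_ , st)
      NF-fun ns nr (arg-step _ _ k st) = ns k st

      NF-var : ∀ {x} → NF (var x)
      NF-var (root-step (_ , _ , σ , uncond i _  , eq , _)) = ⊥-elim (lhs-instance≢var i eq)
      NF-var (root-step (_ , _ , σ , first i _ _ , eq , _)) = ⊥-elim (lhs-instance≢var i eq)
      NF-var (root-step (_ , _ , σ , middle _ _ _ _ , () , _))
      NF-var (root-step (_ , _ , σ , last _ _ _ , () , _))

      Result : UTerm → Set
      Result s = Σ UTerm λ s' → s →* s' × NF s' × back s ↠ back s'

      CondsBelow : (i : I) → ℕ → Subst Sg → Set
      CondsBelow i n σ = ∀ (k : Cond i) → toℕ k < n → (cs I ρ i k ⟨ σ ⟩) ↠ (ct I ρ i k ⟨ σ ⟩)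

      -- The terms met in an innermost evaluation of an original term.
      data Good : UTerm → Set where
        normal : ∀ {s} → NF s → Good s
        args   : ∀ {f us} → (∀ k → Good (vlookup us k)) → Good (fun (inj₁ f) us)
        stage  : ∀ i (j : Cond i) σ → (∀ {x} → x ∈ Xs I ρ i j → NF (σ x)) →
                 CondsBelow i (toℕ j) (back ∘ σ) → Good (U I ρ i j (emb I ρ (cs I ρ i j)) ⟨ σ ⟩)

      mutual
        Good-emb : ∀ e {σ} → (∀ {x} → x ∈ varsM e → NF (σ x)) → Good (emb I ρ e ⟨ σ ⟩)
        Good-emb (var x)    h = normal (h (here refl))
        Good-emb (fun f ts) h = args (Good-embs ts h)

        Good-embs : ∀ {n} (ts : Vec (Term Sg) n) {σ} → (∀ {x} → x ∈ varsMs ts → NF (σ x)) →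
          ∀ k → Good (vlookup (substs (embs I ρ ts) σ) k)
        Good-embs (t ∷ ts) h zero    = Good-emb t (h ∘ ∈-++⁺ˡ)
        Good-embs (t ∷ ts) h (suc k) = Good-embs ts (h ∘ ∈-++⁺ʳ (varsM t)) k

      -- Arguments are evaluated from left to right, each inside the continuation of the previous
      -- one.
      normalise-args : ∀ {n} (us : Vec UTerm n) → (∀ k → K (Result (vlookup us k))) →
        K (Σ (Vec UTerm n) λ us' → Pointwise _→*_ us us' × (∀ k → NF (vlookup us' k)) ×
             Pointwise _↠_ (backs us) (backs us'))
      normalise-args []       h κ = κ ([] , [] , (λ ()) , [])
      normalise-args (u ∷ us) h κ =
        h zero λ { (u' , r , n , b) →
        normalise-args us (h ∘ suc) λ { (us' , rs , ns , bs) →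
        κ (u' ∷ us' , r ∷ rs , (λ { zero → n ; (suc k) → ns k }) , b ∷ bs) } }

      continue : ∀ {s s₁ t} → (∀ {t} → t ≺ s → Good t → K (Result t)) →
        s →* s₁ → UseqStep I ρ s₁ t → back s ↠ back t → Good t → K (Result s)
      continue rec r st b g κ = rec (Star-TransClosure r [ by-step st ]) g
        λ { (s' , r' , n , b') → κ (s' , r ◅◅ st ◅ r' , n , b ◅◅ b') }

      lhs-NF : ∀ i {σ f us} → fun f us ≡ emb I ρ (lhs (ρ i)) ⟨ σ ⟩ → (∀ k → NF (vlookup us k)) →
        ∀ {x} → x ∈ varsM (lhs (ρ i)) → NF (σ x)
      lhs-NF i eq ns p with lhs (ρ i) in e
      ... | var y = ⊥-elim (lhs≢var i e)
      lhs-NF i refl ns p | fun g ts with vars⊴ ts p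
      ...   | k , sub = NF-⊴ sub (ns k)

      -- Since the arguments are normal, so is the matcher on the variables of the left-hand side.
      -- An `uncond` step is a conditional step without conditions; a `first` step leaves the term
      -- read back unchanged and opens a stage.
      fire-lhs : ∀ {s f us t} → (∀ {t} → t ≺ s → Good t → K (Result t)) →
        s →* fun (inj₁ f) us → back s ↠ back (fun (inj₁ f) us) → (∀ k → NF (vlookup us k)) →
        RootStep (fun (inj₁ f) us) t → K (Result s)
      fire-lhs rec r b ns st@(_ , _ , σ , uncond i c≡[] , eq , refl) =
        continue rec r (root-step st)
          (b ◅◅ subst₂ _↠_ (sym (trans (cong back eq) (back-emb (lhs (ρ i))))) (sym (back-emb (rhs (ρ i))))
            (rule-CStep i (back ∘ σ) (subst (All _) (sym c≡[]) []) ◅ ε))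
          (Good-emb (rhs (ρ i)) (lhs-NF i eq ns ∘ rhs⊆lhs det i c≡[]))
      fire-lhs {s} rec r b ns st@(_ , _ , σ , first i j j≡0 , eq , refl) =
        continue rec r (root-step st)
          (subst (back s ↠_)
            (trans (cong back eq) (trans (back-emb (lhs (ρ i))) (sym (back-U i j (emb I ρ (cs I ρ i j)))))) b)
          (stage i j σ (lhs-NF i eq ns ∘ Xs-zero i j j≡0)
            -- No condition precedes the first one.
            (λ k k<j → contradiction (subst (toℕ k <_) j≡0 k<j) λ ()))
      fire-lhs rec r b ns (_ , _ , σ , middle _ _ _ _ , () , _)
      fire-lhs rec r b ns (_ , _ , σ , last _ _ _ , () , _)

      -- `σ` opened the stage; `τ` matches the rule applied once the condition has been evaluated to
      -- `w`. They agree on the stored variables, while `τ` binds the variables of `t_j` inside `w`.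
      module _ (i : I) (j : Cond i) {σ τ : Subst (USig I ρ)} {w : UTerm}
               (w≡ : w ≡ emb I ρ (ct I ρ i j) ⟨ τ ⟩)
               (agree : ∀ {x} → x ∈ Xs I ρ i j → σ x ≡ τ x)
               where

        matched-NF : (∀ {x} → x ∈ Xs I ρ i j → NF (σ x)) → NF w →
          ∀ {x} → x ∈ Xs I ρ i j ⊎ x ∈ varsM (ct I ρ i j) → NF (τ x)
        matched-NF nσ nw (inj₁ p) = subst NF (agree p) (nσ p)
        matched-NF nσ nw (inj₂ p) = NF-⊴ (var⊴ (ct I ρ i j) p) (subst NF w≡ nw)

        -- Conditions before `j` contain only variables on which `σ` and `τ` agree, so they carry
        -- over. Condition `j` holds because `w` is the `τ`-instance of `t_j`.
        matched-conds : CondsBelow i (toℕ j) (back ∘ σ) → (cs I ρ i j ⟨ back ∘ σ ⟩) ↠ back w →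
          CondsBelow i (suc (toℕ j)) (back ∘ τ)
        matched-conds below cond k k<1+j with m<1+n⇒m<n∨m≡n k<1+j
        ... | inj₁ k<j = subst₂ _↠_
          (⟨⟩-cong (cs I ρ i k) (cong back ∘ agree ∘ Xs-mono i k j (<⇒≤ k<j) ∘ cs⊆Xs det i k))
          (⟨⟩-cong (ct I ρ i k) (cong back ∘ agree ∘ ct⊆Xs i k j k<j))
          (below k k<j)
        ... | inj₂ k≡j rewrite toℕ-injective k≡j = subst₂ _↠_
          (⟨⟩-cong (cs I ρ i j) (cong back ∘ agree ∘ cs⊆Xs det i j))
          (trans (cong back w≡) (back-emb (ct I ρ i j)))
          cond

        matched-lhs : lhs (ρ i) ⟨ back ∘ σ ⟩ ≡ lhs (ρ i) ⟨ back ∘ τ ⟩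
        matched-lhs = ⟨⟩-cong (lhs (ρ i)) (cong back ∘ agree ∘ lhs⊆Xs i j)

      -- A `middle` step opens the next stage with `τ`, normal on the new variables because these
      -- are bound inside the normal `w`. A `last` step becomes one conditional step from the
      -- instance of the left-hand side that `s` stands for.
      fire-stage : ∀ i (j : Cond i) {σ w s t} → (∀ {t} → t ≺ s → Good t → K (Result t)) →
        let s₁ = fun (inj₂ (i , j)) (w ∷ substs (vmap var (fromList (Xs I ρ i j))) σ) in
        s →* s₁ → back s ≡ lhs (ρ i) ⟨ back ∘ σ ⟩ →
        (∀ {x} → x ∈ Xs I ρ i j → NF (σ x)) → CondsBelow i (toℕ j) (back ∘ σ) →
        NF w → (cs I ρ i j ⟨ back ∘ σ ⟩) ↠ back w → RootStep s₁ t → K (Result s)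
      fire-stage i j rec r b nσ below nw cond (_ , _ , τ , uncond i' _  , eq , _) = ⊥-elim (lhs-instance≢U i' eq)
      fire-stage i j rec r b nσ below nw cond (_ , _ , τ , first i' _ _ , eq , _) = ⊥-elim (lhs-instance≢U i' eq)
      fire-stage i j {σ} {s = s} rec r b nσ below nw cond st@(_ , _ , τ , middle _ _ j' j'≡ , eq , refl)
        with fun-injectiveˡ eq
      ... | refl = continue rec r (root-step st)
          (subst (back s ↠_) (trans b (trans (matched-lhs i j w≡ agree) (sym (back-U i j' (emb I ρ (cs I ρ i j')))))) ε)
          (stage i j' τ (matched-NF i j w≡ agree nσ nw ∘ Xs-suc i j j' j'≡)
            (subst (λ n → CondsBelow i n (back ∘ τ)) (sym j'≡) (matched-conds i j w≡ agree below cond)))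
        where
        w≡ = proj₁ (∷-injective (fun-injectiveʳ eq))
        agree : ∀ {x} → x ∈ Xs I ρ i j → σ x ≡ τ x
        agree = substs-vars-injective (Xs I ρ i j) (proj₂ (∷-injective (fun-injectiveʳ eq)))
      fire-stage i j {σ} rec r b nσ below nw cond st@(_ , _ , τ , last _ _ 1+j≡ , eq , refl)
        with fun-injectiveˡ eq
      ... | refl = continue rec r (root-step st)
          (subst₂ _↠_ (sym (trans b (matched-lhs i j w≡ agree))) (sym (back-emb (rhs (ρ i))))
            (rule-CStep i (back ∘ τ) (All-lookup⁺ (conds (ρ i))
              -- Here `suc (toℕ j)` is the number of conditions, so all of them are covered.
              (λ k → matched-conds i j w≡ agree below cond k (subst (toℕ k <_) (sym 1+j≡) (toℕ<n k)))) ◅ ε))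
          (Good-emb (rhs (ρ i)) (matched-NF i j w≡ agree nσ nw ∘ rhs⊆last det i j 1+j≡))
        where
        w≡ = proj₁ (∷-injective (fun-injectiveʳ eq))
        agree : ∀ {x} → x ∈ Xs I ρ i j → σ x ≡ τ x
        agree = substs-vars-injective (Xs I ρ i j) (proj₂ (∷-injective (fun-injectiveʳ eq)))

      -- κ first receives the term as if it were normal; should it produce a root
      -- step against that claim, the evaluation resumes with this step and the same κ.
      normalise-by : ∀ {s} → (∀ {t} → t ≺ s → Good t → K (Result t)) → Good s → K (Result s)
      normalise-by rec (normal n) κ = κ (_ , ε , n , ε)
      normalise-by rec (args {f} {us} gs) κ =
        normalise-args us (λ k → rec [ by-arg k ] (gs k)) λ { (us' , rs , ns , bs) →
          let r = Star-args (UseqStep I ρ) (fun (inj₁ f)) (λ ts k → arg-step (inj₁ f) ts k) rs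
              b = CStep-args f bs
          in κ (_ , r , NF-fun ns (λ { (_ , st) → fire-lhs rec r b ns st κ }) , b) }
      normalise-by rec (stage i j σ nσ below) κ =
        rec [ by-arg zero ] (Good-emb (cs I ρ i j) (nσ ∘ cs⊆Xs det i j)) λ { (w , r , nw , b) →
          let xs = substs (vmap var (fromList (Xs I ρ i j))) σ
              r' = Star.gmap (λ a → fun (inj₂ (i , j)) (a ∷ xs)) (λ {a} → arg-step (inj₂ (i , j)) (a ∷ xs) zero) r
              cond = subst (_↠ back w) (back-emb (cs I ρ i j)) b
          in κ (_ , r' ,
                NF-fun (λ { zero → nw ; (suc k) → lookup-substs-vars NF (Xs I ρ i j) nσ k })
                       (λ { (_ , st) → fire-stage i j rec r' (back-U i j (emb I ρ (cs I ρ i j))) nσ below nw cond st κ }) ,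
                -- Only the first argument has changed, and `back` discards it.
                ε) }

      normalise : ∀ {s} → Acc _≺_ s → Good s → K (Result s)
      normalise (acc rs) = normalise-by (λ p → normalise (rs p))

      -- An original term is its own instance under `var`, and variables are normal, so it is
      -- `Good`.
      normalise-emb : ∀ e → K (Result (emb I ρ e))
      normalise-emb e = normalise (Plus.wellFounded _ (StepOrArg-wellFounded _ wf) _)
        (subst Good (⟨var⟩ (emb I ρ e)) (Good-emb e (λ _ → NF-var)))

-- Soundness for reductions to normal forms.

theorem18 : (Sg : Signature) (I : Set) (ρ : I → CRule Sg) →
    (∀ i → Deterministic (ρ i)) →
    RightStable I ρ →
    Confluent (UseqStep I ρ) →
    Terminating (UseqStep I ρ) →
    (u v : Term Sg) →
    Star (UseqStep I ρ) (emb I ρ u) (emb I ρ v) →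
    NormalForm (UseqStep I ρ) (emb I ρ v) →
    Star (CStep I ρ) u v
theorem18 Sg I ρ det _ confluent wf u v u→*v v-normal =
  normalise-emb u λ { (s , u→*s , s-NF , u↠s) →
    let (_ , s→*z , v→*z) = confluent _ _ _ u→*s u→*v in reach u↠s s-NF s→*z v→*z }
  where
  open Normalisation I ρ wf det (Star (CStep I ρ) u v)
  reach : ∀ {s z} → Star (CStep I ρ) (back I ρ (emb I ρ u)) (back I ρ s) → NF s →
    Star (UseqStep I ρ) s z → Star (UseqStep I ρ) (emb I ρ v) z → Star (CStep I ρ) u v
  -- The answer type is the goal itself, so a step out of `s` already yields it.
  reach u↠s s-NF (st ◅ _) _         = s-NF st
  reach u↠s s-NF ε        (st ◅ _)  = ⊥-elim (v-normal (_ , st))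
  reach u↠s s-NF ε        ε         = subst₂ (Star (CStep I ρ)) (back-emb₀ I ρ u) (back-emb₀ I ρ v) u↠s
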